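{- Let $G$ be an interval graph, let $C_1,\dots,C_s$ be a clique path of $G$, let $u_1$ be a vertex of $G$ that belongs to $C_1$ and to no other clique $C_j$ with $j\neq 1$, and let $u_n$ be a vertex of $G$ that belongs to $C_s$ and to no other clique $C_j$ with $j\neq s$. Then for every positive integer $p$, $G$ contains a spanning $p$-stave between $u_1$ and $u_n$ if and only if $\mathrm{scat}(G)\le 2-p$.
   Context: All graphs are finite, undirected, without loops or multiple edges. An interval graph is the intersection graph of a finite set of closed intervals on the real line. A clique path of an interval graph $G$ is a sequence $C_1,\dots,C_s$ of all maximal cliques of $G$ such that every edge of $G$ lies in some $C_i$ and each vertex of $G$ lies only in consecutively indexed cliques (i.e., $\{j : v\in C_j\}$ is a set of consecutive integers for each vertex $v$). For a graph $G$, $c(G)$ denotes its number of connected components. The scattering number is $\mathrm{scat}(G)=\max\{c(G-S)-|S| : S\subset V(G),\ c(G-S)\ge 2\}$, with $\mathrm{scat}(G)=-\infty$ if $G$ is complete. A $p$-stave between vertices $u$ and $v$ is a set of $p$ paths $P_1,\dots,P_p$, each having end-vertices $u$ and $v$, which are pairwise internally vertex-disjoint; it is spanning if $V(P_1)\cup\cdots\cup V(P_p)=V(G)$.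
   Formalization: The vertices u_1 and u_n are assumed distinct (for a complete graph on at least 2 vertices with u_1 = u_n the claim fails), and a p-stave is an indexed family of paths, so the single edge u_1u_n may repeat (needed for complete graphs and large p). -}

module Defs where

open import Data.Nat using (ℕ; zero; suc; _≤_)
open import Data.Fin using (Fin; zero; suc; fromℕ)
import Data.Fin as F
open import Data.Fin.Subset using (Subset; _∈_; _∉_; ∣_∣)
open import Data.List using (List; head; last)
open import Data.List.Membership.Propositional using () renaming (_∈_ to _∈ₗ_)
open import Data.List.Relation.Unary.Unique.Propositional using (Unique)
open import Data.List.Relation.Unary.Linked using (Linked)
open import Data.Maybe using (just)
open import Data.Product using (Σ; ∃; _×_; _,_)
open import Data.Sum using (_⊎_)
open import Data.Integer using (ℤ; +_; _-_) renaming (_≤_ to _≤ℤ_)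
open import Data.Rational using (ℚ) renaming (_≤_ to _≤ℚ_)
open import Function.Bundles using (_⇔_)
open import Relation.Binary.PropositionalEquality using (_≡_; _≢_)
open import Relation.Nullary using (¬_)

record Graph : Set₁ where
  field
    n     : ℕ
    Adj   : Fin n → Fin n → Set
    sym   : ∀ {u v} → Adj u v → Adj v u
    irrefl : ∀ {u} → ¬ Adj u u
open Graph public

-- Interval graph: intersection graph of closed intervals [l v , r v] on the
-- real line (rational endpoints suffice for finitely many intervals).
IsIntervalGraph : Graph → Set
IsIntervalGraph G =
  Σ (Fin (n G) → ℚ) λ l → Σ (Fin (n G) → ℚ) λ r →
    (∀ v → l v ≤ℚ r v) ×
    (∀ u v → u ≢ v → (Adj G u v ⇔ (l u ≤ℚ r v × l v ≤ℚ r u)))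

IsClique : (G : Graph) → Subset (n G) → Set
IsClique G K = ∀ u v → u ∈ K → v ∈ K → u ≢ v → Adj G u v

IsMaximalClique : (G : Graph) → Subset (n G) → Set
IsMaximalClique G K =
  IsClique G K × (∀ w → w ∉ K → ∃ λ u → u ∈ K × u ≢ w × ¬ Adj G w u)

-- A clique path C_1,…,C_s (here indexed by Fin s, C_1 = C zero,
-- C_s = C (fromℕ s')) with s = suc s'.
IsCliquePath : (G : Graph) (s : ℕ) → (Fin s → Subset (n G)) → Set
IsCliquePath G s C =
  (∀ i → IsMaximalClique G (C i)) ×
  (∀ i j → C i ≡ C j → i ≡ j) ×
  (∀ K → IsMaximalClique G K → ∃ λ i → C i ≡ K) ×
  (∀ u v → Adj G u v → ∃ λ i → u ∈ C i × v ∈ C i) ×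
  (∀ v i j k → i F.≤ j → j F.≤ k → v ∈ C i → v ∈ C k → v ∈ C j)

data Reach (G : Graph) (S : Subset (n G)) : Fin (n G) → Fin (n G) → Set where
  here : ∀ {u} → u ∉ S → Reach G S u u
  step : ∀ {u v w} → u ∉ S → Adj G u v → Reach G S v w → Reach G S u w

-- c(G - S) = k : the vertices of G - S are labelled onto Fin k so that two
-- vertices get the same label iff they lie in the same component.
NumComponents : (G : Graph) → Subset (n G) → ℕ → Set
NumComponents G S k =
  Σ ((v : Fin (n G)) → v ∉ S → Fin k) λ comp →
    (∀ u v (hu : u ∉ S) (hv : v ∉ S) → (comp u hu ≡ comp v hv ⇔ Reach G S u v)) ×
    (∀ (c : Fin k) → ∃ λ v → Σ (v ∉ S) λ hv → comp v hv ≡ c)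

-- scat(G) ≤ t, where scat(G) = max { c(G-S) - |S| : c(G-S) ≥ 2 }
-- (and scat(G) = -∞ when no such S exists, e.g. G complete).
ScatLe : Graph → ℤ → Set
ScatLe G t = ∀ (S : Subset (n G)) (k : ℕ) → NumComponents G S k → 2 ≤ k →
  (+ k) - (+ ∣ S ∣) ≤ℤ t

record Path (G : Graph) (u v : Fin (n G)) : Set where
  field
    verts  : List (Fin (n G))
    start  : head verts ≡ just u
    end    : last verts ≡ just v
    simple : Unique verts
    linked : Linked (Adj G) verts
open Path public

SpanningStave : (G : Graph) (p : ℕ) (u v : Fin (n G)) → Set
SpanningStave G p u v =
  Σ (Fin p → Path G u v) λ P →
    (∀ i j → i ≢ j → ∀ w → w ∈ₗ verts (P i) → w ∈ₗ verts (P j) → w ≡ u ⊎ w ≡ v) ×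
    (∀ w → ∃ λ i → w ∈ₗ verts (P i))

{-# OPTIONS --safe #-}
module Submission where

-- A clique path turns the vertices into intervals [a v , b v] of clique indices 0 … s, with
-- u₁ = [0 , 0] and uₙ = [s , s]; a set S disconnects G exactly at the gaps e | e + 1 all of whose
-- crossing vertices lie in S.
--
-- Necessity. Every path of the stave enters the rightmost class of the separated vertices from a
-- vertex of S, and each component strictly between the extreme ones is also entered by some path
-- from a vertex of S. These vertices are distinct, so p + (k - 2) ≤ |S|.
--
-- Sufficiency. Sweep the points 0 … s with p tracks that start at u₁ and are each extended by a
-- free vertex sharing the current point. A track is extended only when its last vertex ends here,
-- or when a free vertex ends here that contains no earlier extension point. The track to be
-- extended is the one whose last vertex ends first, and the new vertex is the free vertex crossing
-- the next gap that ends first. If no such vertex exists, the gaps around the vertices that forced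
-- the extensions give a set S violating the bound on the scattering number. After the sweep every
-- remaining vertex contains a point at which a track was extended, and is inserted there.

open import Defs
open import Data.Nat using (ℕ; zero; suc; _+_; _∸_; _≤_; _<_; z≤n; s≤s; s≤s⁻¹; pred)
import Data.Nat as ℕ
import Data.Nat.Properties as ℕₚ
open import Data.Nat.Properties using (≤-refl; ≤-trans; ≤-reflexive; ≤-total; <⇒≤; <⇒≱; ≤-<-trans; <-≤-trans; ≰⇒>; ≮⇒≥)
open import Data.Fin using (Fin; zero; suc; fromℕ; toℕ)
import Data.Fin as F
import Data.Fin.Properties as Fₚ
open import Data.Fin.Subset using (Subset; _∈_; _∉_; ∣_∣; ⁅_⁆; _∪_; inside; outside) renaming (⊥ to ∅; _-_ to _∖_)
import Data.Fin.Subset.Properties as Sₚ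
open import Data.Integer using (+_; _-_)
import Data.Integer as ℤ
import Data.Integer.Properties as ℤₚ
open import Data.Integer.Tactic.RingSolver using (solve-∀)
open import Data.Vec.Functional using (updateAt)
import Data.Vec.Functional.Properties as VFₚ
open import Data.Vec using ([]; _∷_; tabulate; here; there)
import Data.Vec.Properties as Vₚ
open import Data.List using (List; []; _∷_; _++_; [_]; length; lookup; map; filter; deduplicate; allFin; last; head)
import Data.List.Properties as Lₚ
open import Data.List.Membership.Propositional using (find; lose) renaming (_∈_ to _∈ₗ_; _∉_ to _∉ₗ_)
import Data.List.Membership.Propositional.Properties as Mₚ
open import Data.List.Relation.Unary.Any using (Any; here; there; any?; index)
import Data.List.Relation.Unary.Any.Properties as Anyₚ
import Data.List.Relation.Unary.All as All
import Data.List.Relation.Unary.All.Properties as Allₚ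
open import Data.List.Relation.Unary.All using ([]; _∷_)
open import Data.List.Relation.Unary.AllPairs using ([]; _∷_)
open import Data.List.Relation.Unary.Linked using (Linked; []; [-]; _∷_)
import Data.List.Relation.Unary.Linked.Properties as Linkedₚ
open import Data.List.Relation.Unary.Unique.Propositional using (Unique)
import Data.List.Relation.Unary.Unique.Propositional.Properties as Uniqueₚ
import Data.List.Relation.Unary.Unique.DecPropositional.Properties as DecUniqueₚ
open import Data.Maybe using (just)
open import Data.Maybe.Relation.Binary.Connected using (Connected; just)
open import Data.Product using (Σ; ∃; ∃₂; _×_; _,_; proj₁; proj₂; map₂)
open import Data.Sum using (_⊎_; inj₁; inj₂; [_,_]′)
open import Function using (_∘_; id; case_of_)
open import Function.Bundles using (_⇔_; mk⇔; Equivalence)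
open import Relation.Binary.PropositionalEquality using (_≡_; _≢_; refl; trans; cong; subst; subst₂) renaming (sym to ≡-sym)
open import Relation.Nullary using (¬_; yes; no; does; contradiction)
open import Relation.Nullary.Decidable using (_×-dec_; _→-dec_; ¬?; decidable-stable)
open import Relation.Unary using (Decidable)

-- Finite sets and lists

least : {A : Set} (f : A → ℕ) {x : A} {xs : List A} → x ∈ₗ xs →
  ∃ λ y → y ∈ₗ xs × (∀ {z} → z ∈ₗ xs → f y ≤ f z)
least f {xs = w ∷ []} _ = w , here refl , λ { (here refl) → ≤-refl }
least f {xs = w ∷ v ∷ xs} _ with least f {xs = v ∷ xs} (here refl)
... | y , y∈ , y≤ with ≤-total (f w) (f y)
... | inj₁ w≤y = w , here refl , λ { (here refl) → ≤-refl ; (there z∈) → ≤-trans w≤y (y≤ z∈) }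
... | inj₂ y≤w = y , there y∈ , λ { (here refl) → y≤w ; (there z∈) → y≤ z∈ }

lookup-injective : {A : Set} {xs : List A} → Unique xs →
  ∀ i j → lookup xs i ≡ lookup xs j → i ≡ j
lookup-injective (_ ∷ _) zero zero _ = refl
lookup-injective {xs = _ ∷ xs} (x≢ ∷ _) zero (suc j) eq =
  contradiction eq (All.lookup x≢ (Mₚ.∈-lookup {xs = xs} j))
lookup-injective {xs = _ ∷ xs} (x≢ ∷ _) (suc i) zero eq =
  contradiction (≡-sym eq) (All.lookup x≢ (Mₚ.∈-lookup {xs = xs} i))
lookup-injective (_ ∷ xs!) (suc i) (suc j) eq = cong suc (lookup-injective xs! i j eq)

injection⇒≤∣∣ : ∀ {m N} (T : Subset N) (f : Fin m → Fin N) →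
  (∀ i j → f i ≡ f j → i ≡ j) → (∀ i → f i ∈ T) → m ≤ ∣ T ∣
injection⇒≤∣∣ {zero} T f inj f∈ = z≤n
injection⇒≤∣∣ {suc m} T f inj f∈ = ≤-trans
  (s≤s (injection⇒≤∣∣ (T ∖ f zero) (f ∘ suc)
    (λ i j eq → Fₚ.suc-injective (inj _ _ eq))
    (λ i → Sₚ.x∈p∧x≢y⇒x∈p-y (f∈ (suc i)) (λ eq → case inj _ _ eq of λ ()))))
  (Sₚ.x∈p⇒∣p-x∣<∣p∣ (f∈ zero))

∣p∪q∣≤∣p∣+∣q∣ : ∀ {N} (p q : Subset N) → ∣ p ∪ q ∣ ≤ ∣ p ∣ + ∣ q ∣
∣p∪q∣≤∣p∣+∣q∣ [] [] = z≤n
∣p∪q∣≤∣p∣+∣q∣ (outside ∷ p) (outside ∷ q) = ∣p∪q∣≤∣p∣+∣q∣ p q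
∣p∪q∣≤∣p∣+∣q∣ (outside ∷ p) (inside ∷ q) =
  ≤-trans (s≤s (∣p∪q∣≤∣p∣+∣q∣ p q)) (≤-reflexive (≡-sym (ℕₚ.+-suc ∣ p ∣ ∣ q ∣)))
∣p∪q∣≤∣p∣+∣q∣ (inside ∷ p) (outside ∷ q) = s≤s (∣p∪q∣≤∣p∣+∣q∣ p q)
∣p∪q∣≤∣p∣+∣q∣ (inside ∷ p) (inside ∷ q) =
  s≤s (≤-trans (∣p∪q∣≤∣p∣+∣q∣ p q) (ℕₚ.+-monoʳ-≤ ∣ p ∣ (ℕₚ.n≤1+n _)))

∣∣≤length : ∀ {N} (T : Subset N) (xs : List (Fin N)) →
  (∀ v → v ∈ T → v ∈ₗ xs) → ∣ T ∣ ≤ length xs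
∣∣≤length {N} T xs T⊆ =
  ≤-trans (Sₚ.p⊆q⇒∣p∣≤∣q∣ (λ {v} v∈ → ∈-set (T⊆ v v∈))) (∣set∣ xs)
  where
  set : List (Fin N) → Subset N
  set [] = ∅
  set (x ∷ xs) = ⁅ x ⁆ ∪ set xs
  ∈-set : ∀ {v xs} → v ∈ₗ xs → v ∈ set xs
  ∈-set (here refl) = Sₚ.x∈p∪q⁺ (inj₁ (Sₚ.x∈⁅x⁆ _))
  ∈-set (there v∈) = Sₚ.x∈p∪q⁺ (inj₂ (∈-set v∈))
  ∣set∣ : ∀ xs → ∣ set xs ∣ ≤ length xs
  ∣set∣ [] = ≤-reflexive (Sₚ.∣⊥∣≡0 N)
  ∣set∣ (x ∷ xs) = ≤-trans (∣p∪q∣≤∣p∣+∣q∣ ⁅ x ⁆ (set xs))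
    (ℕₚ.+-mono-≤ (≤-reflexive (Sₚ.∣⁅x⁆∣≡1 x)) (∣set∣ xs))

module _ {N : ℕ} {P : Fin N → Set} (P? : Decidable P) where

  ⟦_⟧ : Subset N
  ⟦_⟧ = tabulate (does ∘ P?)

  ∈⟦⟧⁺ : ∀ {v} → P v → v ∈ ⟦_⟧
  ∈⟦⟧⁺ {v} Pv with P? v in eq
  ... | yes _ = Vₚ.lookup⇒[]= v _ (trans (Vₚ.lookup∘tabulate (does ∘ P?) v) (cong does eq))
  ... | no ¬Pv = contradiction Pv ¬Pv

  ∈⟦⟧⁻ : ∀ {v} → v ∈ ⟦_⟧ → P v
  ∈⟦⟧⁻ {v} v∈ with P? v in eq
  ... | yes Pv = Pv
  ... | no _ = case trans (≡-sym (trans (Vₚ.lookup∘tabulate (does ∘ P?) v) (cong does eq)))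
                         (Vₚ.[]=⇒lookup v∈) of λ ()

updateAt-elim : ∀ {A : Set} {m} (xs : Fin m → A) (i : Fin m) (x : A) (Q : Fin m → A → Set) →
  Q i x → (∀ j → j ≢ i → Q j (xs j)) → ∀ j → Q j (updateAt xs i (λ _ → x) j)
updateAt-elim xs i x Q q₀ q j with j F.≟ i
... | yes refl = subst (Q i) (≡-sym (VFₚ.updateAt-updates i xs)) q₀
... | no j≢ = subst (Q j) (≡-sym (VFₚ.updateAt-minimal j i xs j≢)) (q j j≢)

distinct-pair : ∀ {k} → 2 ≤ k → ∃₂ λ (c d : Fin k) → c ≢ d
distinct-pair (s≤s (s≤s _)) = zero , suc zero , λ ()

data Consecutive {A : Set} (x y : A) : List A → Set where
  here  : ∀ {xs} → Consecutive x y (x ∷ y ∷ xs)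
  there : ∀ {z xs} → Consecutive x y xs → Consecutive x y (z ∷ xs)

consecutive⇒∈ : ∀ {A : Set} {x y : A} {xs} → Consecutive x y xs → x ∈ₗ xs
consecutive⇒∈ here = here refl
consecutive⇒∈ (there c) = there (consecutive⇒∈ c)

consecutive-unique : ∀ {A : Set} {x y y′ : A} {xs} → Unique xs →
  Consecutive x y xs → Consecutive x y′ xs → y ≡ y′
consecutive-unique _ here here = refl
consecutive-unique (x≢ ∷ _) here (there c) = contradiction refl (All.lookup x≢ (consecutive⇒∈ c))
consecutive-unique (x≢ ∷ _) (there c) here = contradiction refl (All.lookup x≢ (consecutive⇒∈ c))
consecutive-unique (_ ∷ xs!) (there c) (there c′) = consecutive-unique xs! c c′

head⇒∷ : ∀ {A : Set} {x : A} xs → head xs ≡ just x → ∃ λ ys → xs ≡ x ∷ ys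
head⇒∷ (x ∷ ys) refl = ys , refl

last⇒∈ : ∀ {A : Set} {x : A} xs → last xs ≡ just x → x ∈ₗ xs
last⇒∈ (x ∷ []) refl = here refl
last⇒∈ (_ ∷ y ∷ xs) eq = there (last⇒∈ (y ∷ xs) eq)

-- Adding `p + σ` to both sides turns the bound on the scattering number into a count of natural
-- numbers.
-‿≤⇒+≤ : ∀ k σ p → (+ k) - (+ σ) ℤ.≤ (+ 2) - (+ p) → p + k ≤ 2 + σ
-‿≤⇒+≤ k σ p h = ℤₚ.drop‿+≤+ (subst₂ ℤ._≤_
  (trans (lhs (+ k) (+ σ) (+ p)) (≡-sym (ℤₚ.pos-+ p k)))
  (trans (rhs (+ σ) (+ p)) (≡-sym (ℤₚ.pos-+ 2 σ)))
  (ℤₚ.+-monoˡ-≤ ((+ p) ℤ.+ (+ σ)) h))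
  where
  lhs : ∀ k σ p → (k - σ) ℤ.+ (p ℤ.+ σ) ≡ p ℤ.+ k
  lhs = solve-∀
  rhs : ∀ σ p → ((+ 2) - p) ℤ.+ (p ℤ.+ σ) ≡ (+ 2) ℤ.+ σ
  rhs = solve-∀

+≤⇒-‿≤ : ∀ k σ p → p + k ≤ 2 + σ → (+ k) - (+ σ) ℤ.≤ (+ 2) - (+ p)
+≤⇒-‿≤ k σ p h = subst₂ ℤ._≤_
  (trans (cong (ℤ._+ (ℤ.- (+ p) - (+ σ))) (ℤₚ.pos-+ p k)) (lhs (+ k) (+ σ) (+ p)))
  (trans (cong (ℤ._+ (ℤ.- (+ p) - (+ σ))) (ℤₚ.pos-+ 2 σ)) (rhs (+ σ) (+ p)))
  (ℤₚ.+-monoˡ-≤ (ℤ.- (+ p) - (+ σ)) (ℤ.+≤+ h))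
  where
  lhs : ∀ k σ p → (p ℤ.+ k) ℤ.+ (ℤ.- p - σ) ≡ k - σ
  lhs = solve-∀
  rhs : ∀ σ p → ((+ 2) ℤ.+ σ) ℤ.+ (ℤ.- p - σ) ≡ (+ 2) - p
  rhs = solve-∀

-- Gaps of an interval model

module Intervals (G : Graph) (a b : Fin (n G) → ℕ) (s : ℕ)
  (a≤b : ∀ v → a v ≤ b v) (b≤s : ∀ v → b v ≤ s)
  (adj⇒≤ : ∀ {u v} → Adj G u v → a u ≤ b v)
  (≤⇒adj : ∀ {u v} → u ≢ v → a u ≤ b v → a v ≤ b u → Adj G u v) where

  V : Set
  V = Fin (n G)

  -- v meets both e and e + 1, the two ends of the gap e
  Cross : ℕ → V → Set
  Cross e v = a v ≤ e × e < b v

  cross? : ∀ e → Decidable (Cross e)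
  cross? e v = (a v ℕ.≤? e) ×-dec (e ℕ.<? b v)

  _∋_ : V → ℕ → Set
  v ∋ τ = a v ≤ τ × τ ≤ b v

  ∋⇒adj : ∀ {u v τ} → u ≢ v → u ∋ τ → v ∋ τ → Adj G u v
  ∋⇒adj u≢v (u₁ , u₂) (v₁ , v₂) = ≤⇒adj u≢v (≤-trans u₁ v₂) (≤-trans v₁ u₂)

  -- Separating gaps and the components of G - S

  module Separation (S : Subset (n G)) where

    Sep : ℕ → Set
    Sep e = ∀ v → Cross e v → v ∈ S

    sep? : Decidable Sep
    sep? e = Fₚ.all? (λ v → cross? e v →-dec (v Sₚ.∈? S))

    ¬sep⇒crossing : ∀ {e} → ¬ Sep e → ∃ λ v → Cross e v × v ∉ S
    ¬sep⇒crossing {e} ¬sep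
      with v , ¬Pv ← Fₚ.¬∀⟶∃¬ _ _ (λ v → cross? e v →-dec (v Sₚ.∈? S)) ¬sep
      with cross? e v
    ... | yes c = v , c , λ v∈ → ¬Pv (λ _ → v∈)
    ... | no ¬c = contradiction (λ c → contradiction c ¬c) ¬Pv

    count : ℕ → ℕ
    count zero = 0
    count (suc e) with sep? e
    ... | yes _ = suc (count e)
    ... | no _ = count e

    count-step : ∀ e → count e ≤ count (suc e)
    count-step e with sep? e
    ... | yes _ = ℕₚ.n≤1+n _
    ... | no _ = ≤-refl

    count-mono : ∀ {x y} → x ≤ y → count x ≤ count y
    count-mono {x} x≤y = go (ℕₚ.≤⇒≤′ x≤y)
      where
      go : ∀ {y} → x ℕ.≤′ y → count x ≤ count y
      go (ℕ.≤′-reflexive refl) = ≤-refl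
      go (ℕ.≤′-step {y} x≤y) = ≤-trans (go x≤y) (count-step y)

    count-sep : ∀ {e} → Sep e → count e < count (suc e)
    count-sep {e} sep with sep? e
    ... | yes _ = ≤-refl
    ... | no ¬sep = contradiction sep ¬sep

    count-¬sep : ∀ {x y} → x ≤ y → (∀ e → x ≤ e → e < y → ¬ Sep e) → count x ≡ count y
    count-¬sep {x} x≤y = go (ℕₚ.≤⇒≤′ x≤y)
      where
      go : ∀ {y} → x ℕ.≤′ y → (∀ e → x ≤ e → e < y → ¬ Sep e) → count x ≡ count y
      go (ℕ.≤′-reflexive refl) _ = refl
      go (ℕ.≤′-step {y} x≤y) ¬sep with sep? y
      ... | yes sep = contradiction sep (¬sep y (ℕₚ.≤′⇒≤ x≤y) ≤-refl)
      ... | no _ = go x≤y (λ e x≤e e<y → ¬sep e x≤e (ℕₚ.m<n⇒m<1+n e<y))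

    -- A complete invariant of the components among the vertices outside `S`, increasing from left
    -- to right.
    label : V → ℕ
    label v = count (a v)

    -- `S` may contain `u₁` or `uₙ`, but these cross no gap and are never cut. Hence entrances are
    -- counted with `Cut` instead of membership in `S`.
    Cut : V → Set
    Cut v = ∃ λ e → Sep e × Cross e v

    cut⇒∈ : ∀ {v} → Cut v → v ∈ S
    cut⇒∈ {v} (_ , sep , c) = sep v c

    cut? : Decidable Cut
    cut? v with Fₚ.any? {n = s} (λ i → sep? (toℕ i) ×-dec cross? (toℕ i) v)
    ... | yes (i , sep , c) = yes (toℕ i , sep , c)
    ... | no ¬cut = no λ { (e , sep , c) → ¬cut (F.fromℕ< (e<s c) ,
            subst Sep (≡-sym (Fₚ.toℕ-fromℕ< (e<s c))) sep ,
            subst (λ e → Cross e v) (≡-sym (Fₚ.toℕ-fromℕ< (e<s c))) c) }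
      where
      e<s : ∀ {e} → Cross e v → e < s
      e<s (_ , e<b) = <-≤-trans e<b (b≤s v)

    -- A separating gap between the two left ends would be crossed by the vertex that begins first,
    -- since adjacency makes it reach the left end of the other. That vertex would be cut.
    adj⇒label≡ : ∀ {u v} → Adj G u v → ¬ Cut u → ¬ Cut v → label u ≡ label v
    adj⇒label≡ {u} {v} uv ¬u ¬v with ≤-total (a u) (a v)
    ... | inj₁ u≤v = count-¬sep u≤v (λ e u≤e e<v sep →
            ¬u (e , sep , u≤e , <-≤-trans e<v (adj⇒≤ (sym G uv))))
    ... | inj₂ v≤u = ≡-sym (count-¬sep v≤u (λ e v≤e e<u sep →
            ¬v (e , sep , v≤e , <-≤-trans e<u (adj⇒≤ uv))))

    reach-start∉ : ∀ {u v} → Reach G S u v → u ∉ S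
    reach-start∉ (here u∉) = u∉
    reach-start∉ (step u∉ _ _) = u∉

    reach⇒label≡ : ∀ {u v} → Reach G S u v → label u ≡ label v
    reach⇒label≡ (here _) = refl
    reach⇒label≡ (step u∉ uv r) =
      trans (adj⇒label≡ uv (u∉ ∘ cut⇒∈) (reach-start∉ r ∘ cut⇒∈)) (reach⇒label≡ r)

    reach-trans : ∀ {u v w} → Reach G S u v → Reach G S v w → Reach G S u w
    reach-trans (here _) r = r
    reach-trans (step u∉ uv r) r′ = step u∉ uv (reach-trans r r′)

    reach-sym : ∀ {u v} → Reach G S u v → Reach G S v u
    reach-sym (here u∉) = here u∉
    reach-sym (step u∉ uv r) =
      reach-trans (reach-sym r) (step (reach-start∉ r) (sym G uv) (here u∉))

    ∋⇒reach : ∀ {u v τ} → u ∉ S → v ∉ S → u ∋ τ → v ∋ τ → Reach G S u v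
    ∋⇒reach {u} {v} u∉ v∉ u∋ v∋ with u F.≟ v
    ... | yes refl = here u∉
    ... | no u≢v = step u∉ (∋⇒adj u≢v u∋ v∋) (here v∉)

    -- Equal labels leave no separating gap between the two left ends, so every gap there is crossed
    -- by a vertex outside `S`. Vertices crossing successive gaps share a point, which gives a walk.
    label≡⇒reach-≤ : ∀ {u v} → u ∉ S → v ∉ S → a u ≤ a v → label u ≡ label v → Reach G S u v
    label≡⇒reach-≤ {u} {v} u∉ v∉ u≤v eq = go (ℕₚ.≤⇒≤′ u≤v) ≤-refl v∉ (≤-refl , a≤b v)
      where
      go : ∀ {q} → a u ℕ.≤′ q → q ≤ a v → ∀ {x} → x ∉ S → x ∋ q → Reach G S u x
      go (ℕ.≤′-reflexive refl) _ x∉ x∋ = ∋⇒reach u∉ x∉ (≤-refl , a≤b u) x∋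
      go (ℕ.≤′-step {q} u≤q) q<v {x} x∉ x∋
        with y , (ay≤q , q<by) , y∉ ← ¬sep⇒crossing {q} (λ sep → ℕₚ.<-irrefl eq
               (≤-<-trans (count-mono (ℕₚ.≤′⇒≤ u≤q)) (<-≤-trans (count-sep sep) (count-mono q<v)))) =
        reach-trans (go u≤q (<⇒≤ q<v) y∉ (ay≤q , <⇒≤ q<by))
                    (∋⇒reach y∉ x∉ (ℕₚ.m≤n⇒m≤1+n ay≤q , q<by) x∋)

    label≡⇒reach : ∀ {u v} → u ∉ S → v ∉ S → label u ≡ label v → Reach G S u v
    label≡⇒reach {u} {v} u∉ v∉ eq with ≤-total (a u) (a v)
    ... | inj₁ u≤v = label≡⇒reach-≤ u∉ v∉ u≤v eq
    ... | inj₂ v≤u = reach-sym (label≡⇒reach-≤ v∉ u∉ v≤u (≡-sym eq))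

    components : ∃ (NumComponents G S)
    components = length labels , comp , comp-reach , comp-onto
      where
      outside? : Decidable (_∉ S)
      outside? v = ¬? (v Sₚ.∈? S)
      labels : List ℕ
      labels = deduplicate ℕₚ._≟_ (map label (filter outside? (allFin (n G))))
      label∈ : ∀ v → v ∉ S → label v ∈ₗ labels
      label∈ v v∉ = Mₚ.∈-deduplicate⁺ ℕₚ._≟_ (Mₚ.∈-map⁺ label (Mₚ.∈-filter⁺ outside? (Mₚ.∈-allFin v) v∉))
      labels! : Unique labels
      labels! = DecUniqueₚ.deduplicate-! ℕₚ._≟_ _
      comp : ∀ v → v ∉ S → Fin (length labels)
      comp v v∉ = index (label∈ v v∉)
      lookup-comp : ∀ v v∉ → label v ≡ lookup labels (comp v v∉)
      lookup-comp v v∉ = Anyₚ.lookup-index (label∈ v v∉)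
      comp-reach : ∀ u v (u∉ : u ∉ S) (v∉ : v ∉ S) → comp u u∉ ≡ comp v v∉ ⇔ Reach G S u v
      comp-reach u v u∉ v∉ = mk⇔
        (λ eq → label≡⇒reach u∉ v∉ (trans (lookup-comp u u∉)
                  (trans (cong (lookup labels) eq) (≡-sym (lookup-comp v v∉)))))
        (λ r → lookup-injective labels! _ _ (trans (≡-sym (lookup-comp u u∉))
                  (trans (reach⇒label≡ r) (lookup-comp v v∉))))
      comp-onto : ∀ c → ∃ λ v → Σ (v ∉ S) λ v∉ → comp v v∉ ≡ c
      comp-onto c
        with v , v∈ , eq ← Mₚ.∈-map⁻ label (Mₚ.∈-deduplicate⁻ ℕₚ._≟_ _ (Mₚ.∈-lookup {xs = labels} c))
        with _ , v∉ ← Mₚ.∈-filter⁻ outside? {xs = allFin (n G)} v∈ =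
        v , v∉ , lookup-injective labels! _ _ (trans (≡-sym (lookup-comp v v∉)) (≡-sym eq))

    labels≤components : ∀ {k} → NumComponents G S k → (ℓs : List ℕ) → Unique ℓs →
      (∀ {ℓ} → ℓ ∈ₗ ℓs → ∃ λ v → v ∉ S × label v ≡ ℓ) → length ℓs ≤ k
    labels≤components (comp , comp-reach , _) ℓs ℓs! witness = Fₚ.injective⇒≤ {f = f} f-injective
      where
      w : ∀ i → ∃ λ v → v ∉ S × label v ≡ lookup ℓs i
      w i = witness (Mₚ.∈-lookup i)
      f : Fin (length ℓs) → Fin _
      f i = comp (proj₁ (w i)) (proj₁ (proj₂ (w i)))
      f-injective : ∀ {i j} → f i ≡ f j → i ≡ j
      f-injective {i} {j} eq = lookup-injective ℓs! i j (trans (≡-sym (proj₂ (proj₂ (w i))))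
        (trans (reach⇒label≡ (Equivalence.to (comp-reach _ _ _ _) eq)) (proj₂ (proj₂ (w j)))))

  module Ends (u₁ uₙ : V) (u₁≢uₙ : u₁ ≢ uₙ) (b[u₁]≡0 : b u₁ ≡ 0) (a[uₙ]≡s : a uₙ ≡ s) where

    a[u₁]≡0 : a u₁ ≡ 0
    a[u₁]≡0 = ℕₚ.n≤0⇒n≡0 (≤-trans (a≤b u₁) (≤-reflexive b[u₁]≡0))

    ¬cross-u₁ : ∀ {e} → ¬ Cross e u₁
    ¬cross-u₁ (_ , e<b) with () ← <-≤-trans e<b (≤-reflexive b[u₁]≡0)

    ¬cross-uₙ : ∀ {e} → ¬ Cross e uₙ
    ¬cross-uₙ (a≤e , e<b) =
      <⇒≱ (<-≤-trans e<b (b≤s uₙ)) (≤-trans (≤-reflexive (≡-sym a[uₙ]≡s)) a≤e)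

    -- Necessity: counting entrances

    module Necessity {p k : ℕ} {S : Subset (n G)} (stave : SpanningStave G p u₁ uₙ)
      (cs : NumComponents G S k) (2≤k : 2 ≤ k) where

      open Separation S

      P : Fin p → Path G u₁ uₙ
      P = proj₁ stave

      top : ℕ
      top = label uₙ

      rep : Fin k → V
      rep c = proj₁ (proj₂ (proj₂ cs) c)

      rep∉ : ∀ c → rep c ∉ S
      rep∉ c = proj₁ (proj₂ (proj₂ (proj₂ cs) c))

      comp-rep : ∀ c → proj₁ cs (rep c) (rep∉ c) ≡ c
      comp-rep c = proj₂ (proj₂ (proj₂ (proj₂ cs) c))

      label-rep-injective : ∀ c d → label (rep c) ≡ label (rep d) → c ≡ d
      label-rep-injective c d eq = trans (≡-sym (comp-rep c)) (trans
        (Equivalence.from (proj₁ (proj₂ cs) _ _ (rep∉ c) (rep∉ d)) (label≡⇒reach (rep∉ c) (rep∉ d) eq))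
        (comp-rep d))

      label≤top : ∀ v → label v ≤ top
      label≤top v = count-mono (≤-trans (a≤b v) (≤-trans (b≤s v) (≤-reflexive (≡-sym a[uₙ]≡s))))

      label-u₁ : label u₁ ≡ 0
      label-u₁ = cong count a[u₁]≡0

      -- Two components have different labels. Since every path starts at label `0`, this forces
      -- each of them to enter the class of `uₙ`.
      top≢0 : top ≢ 0
      top≢0 top≡0 with c , d , c≢d ← distinct-pair 2≤k =
        c≢d (label-rep-injective c d (trans (low (rep c)) (≡-sym (low (rep d)))))
        where
        low : ∀ v → label v ≡ 0
        low v = ℕₚ.n≤0⇒n≡0 (≤-trans (label≤top v) (≤-reflexive top≡0))

      Entrance : List V → ℕ → V → Set
      Entrance xs ℓ v = Cut v × ∃ λ y → Consecutive v y xs × label y ≡ ℓ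

      entrance-there : ∀ {ℓ h xs} → ∃ (Entrance xs ℓ) → ∃ (Entrance (h ∷ xs) ℓ)
      entrance-there (v , cut , y , c , y≡) = v , cut , y , there c , y≡

      -- The first uncut vertex of label `ℓ` after `h` has a cut predecessor, because an uncut one
      -- would carry the same label. The condition on `h` says that `h` itself is no uncut vertex of
      -- label `ℓ`.
      entrance : ∀ {ℓ h w} xs → Linked (Adj G) (h ∷ xs) → Cut h ⊎ label h ≢ ℓ →
        w ∈ₗ h ∷ xs → ¬ Cut w → label w ≡ ℓ → ∃ (Entrance (h ∷ xs) ℓ)
      entrance xs lk (inj₁ cut) (here refl) ¬w w≡ = contradiction cut ¬w
      entrance xs lk (inj₂ h≢) (here refl) ¬w w≡ = contradiction w≡ h≢
      entrance {ℓ} {h} (x ∷ xs) (hx ∷ lk) good (there w∈) ¬w w≡ with cut? x | label x ℕₚ.≟ ℓ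
      ... | yes cut | _ = entrance-there (entrance xs lk (inj₁ cut) w∈ ¬w w≡)
      ... | no _ | no x≢ = entrance-there (entrance xs lk (inj₂ x≢) w∈ ¬w w≡)
      ... | no ¬x | yes x≡ with cut? h | good
      ...   | yes cut | _ = h , cut , x , here , x≡
      ...   | no ¬h | inj₁ cut = contradiction cut ¬h
      ...   | no ¬h | inj₂ h≢ = contradiction (trans (adj⇒label≡ hx ¬h ¬x) x≡) h≢

      entrance-path : ∀ {ℓ w} i → ℓ ≢ 0 → w ∈ₗ verts (P i) → ¬ Cut w → label w ≡ ℓ →
        ∃ (Entrance (verts (P i)) ℓ)
      entrance-path i ℓ≢0 w∈ ¬w w≡ with ys , eq ← head⇒∷ (verts (P i)) (start (P i)) =
        subst (λ xs → ∃ (Entrance xs _)) (≡-sym eq)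
          (entrance ys (subst (Linked (Adj G)) eq (linked (P i)))
            (inj₂ (λ u₁≡ → ℓ≢0 (trans (≡-sym u₁≡) label-u₁))) (subst (_ ∈ₗ_) eq w∈) ¬w w≡)

      -- A cut vertex is neither `u₁` nor `uₙ`, so it lies on one path only, and its successor there
      -- is unique.
      entrance-injective : ∀ {i j ℓ ℓ′ v} → Entrance (verts (P i)) ℓ v → Entrance (verts (P j)) ℓ′ v →
        i ≡ j × ℓ ≡ ℓ′
      entrance-injective {i} {j} ((_ , _ , cross) , y , c , y≡) (_ , y′ , c′ , y′≡) with i F.≟ j
      ... | yes refl = refl ,
              trans (≡-sym y≡) (trans (cong label (consecutive-unique (simple (P i)) c c′)) y′≡)
      ... | no i≢j with proj₁ (proj₂ stave) i j i≢j _ (consecutive⇒∈ c) (consecutive⇒∈ c′)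
      ...   | inj₁ refl = contradiction cross ¬cross-u₁
      ...   | inj₂ refl = contradiction cross ¬cross-uₙ

      -- The values `zero` and `suc zero` are two spare elements beside the vertices, given to the
      -- components of labels `0` and `top`. They are the constant 2 in the final bound.
      data Image : Fin p ⊎ Fin k → Fin (2 + n G) → Set where
        path    : ∀ {i v} → Entrance (verts (P i)) top v → Image (inj₁ i) (suc (suc v))
        lowest  : ∀ {c} → label (rep c) ≡ 0 → Image (inj₂ c) zero
        highest : ∀ {c} → label (rep c) ≡ top → Image (inj₂ c) (suc zero)
        middle  : ∀ {i c v} → label (rep c) ≢ top → Entrance (verts (P i)) (label (rep c)) v →
                  Image (inj₂ c) (suc (suc v))

      image : ∀ d → ∃ (Image d)
      image (inj₁ i) with v , ent ← entrance-path i top≢0 (last⇒∈ _ (end (P i)))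
                                      (λ { (_ , _ , c) → ¬cross-uₙ c }) refl =
        suc (suc v) , path ent
      image (inj₂ c) with label (rep c) ℕₚ.≟ 0 | label (rep c) ℕₚ.≟ top
      ... | yes ≡0 | _ = zero , lowest ≡0
      ... | no _ | yes ≡top = suc zero , highest ≡top
      ... | no ≢0 | no ≢top
        with i , w∈ ← proj₂ (proj₂ stave) (rep c)
        with v , ent ← entrance-path i ≢0 w∈ (rep∉ c ∘ cut⇒∈) refl = suc (suc v) , middle ≢top ent

      image-injective : ∀ {d d′ x} → Image d x → Image d′ x → d ≡ d′
      image-injective (path e) (path e′) = cong inj₁ (proj₁ (entrance-injective e e′))
      image-injective (path e) (middle ≢top e′) =
        contradiction (≡-sym (proj₂ (entrance-injective e e′))) ≢top
      image-injective (middle ≢top e) (path e′) =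
        contradiction (proj₂ (entrance-injective e e′)) ≢top
      image-injective (middle _ e) (middle _ e′) =
        cong inj₂ (label-rep-injective _ _ (proj₂ (entrance-injective e e′)))
      image-injective (lowest c≡) (lowest d≡) =
        cong inj₂ (label-rep-injective _ _ (trans c≡ (≡-sym d≡)))
      image-injective (highest c≡) (highest d≡) =
        cong inj₂ (label-rep-injective _ _ (trans c≡ (≡-sym d≡)))

      image∈ : ∀ {d x} → Image d x → x ∈ inside ∷ inside ∷ S
      image∈ (path (cut , _)) = there (there (cut⇒∈ cut))
      image∈ (lowest _) = here
      image∈ (highest _) = there here
      image∈ (middle _ (cut , _)) = there (there (cut⇒∈ cut))

      bound : p + k ≤ 2 + ∣ S ∣
      bound = injection⇒≤∣∣ (inside ∷ inside ∷ S) f f-injective (λ i → image∈ (proj₂ (image (F.splitAt p i))))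
        where
        f : Fin (p + k) → Fin (2 + n G)
        f i = proj₁ (image (F.splitAt p i))
        f-injective : ∀ i j → f i ≡ f j → i ≡ j
        f-injective i j eq = trans (≡-sym (Fₚ.join-splitAt p k i)) (trans
          (cong (F.join p k) (image-injective (proj₂ (image (F.splitAt p i)))
            (subst (Image _) (≡-sym eq) (proj₂ (image (F.splitAt p j))))))
          (Fₚ.join-splitAt p k j))

    stave⇒scat : ∀ {p} → SpanningStave G p u₁ uₙ → ScatLe G ((+ 2) - (+ p))
    stave⇒scat {p} stave S k cs 2≤k = +≤⇒-‿≤ k ∣ S ∣ p (Necessity.bound stave cs 2≤k)

    -- Zigzags and bottlenecks

    Crossed : List ℕ → V → Set
    Crossed es v = Any (λ e → Cross e v) es

    crossed? : ∀ es → Decidable (Crossed es)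
    crossed? es v = any? (λ e → cross? e v) es

    -- Gaps es (the rightmost one being g) with one vertex of ws to the left of each of them.
    data Zigzag : ℕ → List ℕ → List V → Set where
      base : ∀ {g} → Zigzag g [ g ] [ u₁ ]
      turn : ∀ {e g z es ws} → Zigzag e es ws → e < a z → b z ≤ g → Zigzag g (g ∷ es) (z ∷ ws)

    zigzag-last : ∀ {g es ws} → Zigzag g es ws → g ∈ₗ es
    zigzag-last base = here refl
    zigzag-last (turn _ _ _) = here refl

    zigzag-gaps≤ : ∀ {g es ws f} → Zigzag g es ws → f ∈ₗ es → f ≤ g
    zigzag-gaps≤ base (here refl) = ≤-refl
    zigzag-gaps≤ (turn _ _ _) (here refl) = ≤-refl
    zigzag-gaps≤ (turn {z = z} zz e<a b≤g) (there f∈) =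
      ≤-trans (zigzag-gaps≤ zz f∈) (≤-trans (<⇒≤ e<a) (≤-trans (a≤b z) b≤g))

    zigzag-verts≤ : ∀ {g es ws w} → Zigzag g es ws → w ∈ₗ ws → b w ≤ g
    zigzag-verts≤ base (here refl) = ≤-trans (≤-reflexive b[u₁]≡0) z≤n
    zigzag-verts≤ (turn _ _ b≤g) (here refl) = b≤g
    zigzag-verts≤ (turn {z = z} zz e<a b≤g) (there w∈) =
      ≤-trans (zigzag-verts≤ zz w∈) (≤-trans (<⇒≤ e<a) (≤-trans (a≤b z) b≤g))

    beyond⇒¬crossed : ∀ {g es ws z} → Zigzag g es ws → g < a z → ¬ Crossed es z
    beyond⇒¬crossed zz g<a crossed with f , f∈ , a≤f , _ ← find crossed =
      <⇒≱ g<a (≤-trans a≤f (zigzag-gaps≤ zz f∈))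

    -- Each vertex of `ws` ends by the gap on its right and begins after those on its left. It thus
    -- survives the deletion of all vertices crossing `es` and can represent a component.
    zigzag-¬crossed : ∀ {g es ws w} → Zigzag g es ws → w ∈ₗ ws → ¬ Crossed es w
    zigzag-¬crossed base (here refl) (here c) = ¬cross-u₁ c
    zigzag-¬crossed (turn zz e<a b≤g) (here refl) (here (_ , g<b)) = <⇒≱ g<b b≤g
    zigzag-¬crossed (turn zz e<a b≤g) (here refl) (there c) = beyond⇒¬crossed zz e<a c
    zigzag-¬crossed zz@(turn _ _ _) (there w∈) (here (_ , g<b)) =
      <⇒≱ g<b (zigzag-verts≤ zz (there w∈))
    zigzag-¬crossed (turn zz _ _) (there w∈) (there c) = zigzag-¬crossed zz w∈ c

    module _ {S : Subset (n G)} where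
      open Separation S

      -- The vertices of `ws` end by the separating gap `g` and `z` begins after it, so its label is
      -- larger; the same argument applies at each turn. With `uₙ` as `z` this gives one component
      -- more than `ws` has entries.
      zigzag-labels : ∀ {g es ws z} → Zigzag g es ws → (∀ {e} → e ∈ₗ es → Sep e) → g < a z →
        Unique (map label (z ∷ ws))
      zigzag-labels {g} {ws = ws} {z} zz sep g<a = Allₚ.map⁺ (All.tabulate distinct) ∷ rest zz sep
        where
        distinct : ∀ {w} → w ∈ₗ ws → label z ≢ label w
        distinct {w} w∈ eq = ℕₚ.<-irrefl (≡-sym eq)
          (≤-<-trans (count-mono (≤-trans (a≤b w) (zigzag-verts≤ zz w∈)))
            (<-≤-trans (count-sep (sep (zigzag-last zz))) (count-mono g<a)))
        rest : ∀ {g es ws} → Zigzag g es ws → (∀ {e} → e ∈ₗ es → Sep e) → Unique (map label ws)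
        rest base _ = [] ∷ []
        rest (turn zz e<a _) sep = zigzag-labels zz (sep ∘ there) e<a

    -- A candidate separator consists of the vertices crossing `gaps`. Apart from those that satisfy
    -- `N` and cross `g`, it has fewer vertices than there are sides, so the bound on the scattering
    -- number forces many of the former.
    record Bottleneck (N : V → Set) (g : ℕ) : Set where
      field
        {gaps}  : List ℕ
        {sides} : List V
        zigzag  : Zigzag g gaps sides
        others  : List V
        few     : length others < length sides
        cover   : ∀ v → Crossed gaps v → v ∈ₗ others ⊎ (N v × Cross g v)

    Bottleneck-map : ∀ {N N′ g} → (∀ {v} → Cross g v → N v → N′ v) → Bottleneck N g → Bottleneck N′ g
    Bottleneck-map {N} {N′} {g} f B = record
      { zigzag = zigzag ; others = others ; few = few ; cover = λ v c → [ inj₁ , keep ]′ (cover v c) }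
      where
      open Bottleneck B
      keep : ∀ {v A} → N v × Cross g v → A ⊎ (N′ v × Cross g v)
      keep (Nv , c) = inj₂ (f c Nv , c)

    -- Tracks

    -- A path from u₁, listed backwards; the tag of an edge is a point common to its two ends.
    data Chain : V → List V → List ℕ → Set where
      root : Chain u₁ [ u₁ ] []
      link : ∀ {x y xs ts τ} → Chain x xs ts → x ∋ τ → y ∋ τ → y ∉ₗ xs → Chain y (y ∷ xs) (τ ∷ ts)

    chain-end∈ : ∀ {x xs ts} → Chain x xs ts → x ∈ₗ xs
    chain-end∈ root = here refl
    chain-end∈ (link _ _ _ _) = here refl

    -- `u₁` contains no point but `0`, so the edge that leaves it is tagged `0`. This tag serves the
    -- vertices that begin at `0`.
    chain-tag-0 : ∀ {x xs ts} → Chain x xs ts → x ≢ u₁ → 0 ∈ₗ ts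
    chain-tag-0 root x≢ = contradiction refl x≢
    chain-tag-0 (link {x} c (_ , τ≤b) _ _) _ with x F.≟ u₁
    ... | yes refl = here (≡-sym (ℕₚ.n≤0⇒n≡0 (≤-trans τ≤b (≤-reflexive b[u₁]≡0))))
    ... | no x≢ = there (chain-tag-0 c x≢)

    record Inserted (z : V) (y : V) (xs : List V) (ts : List ℕ) : Set where
      field
        {xs′}  : List V
        {ts′}  : List ℕ
        chain′ : Chain y xs′ ts′
        new    : z ∈ₗ xs′
        old    : ∀ {v} → v ∈ₗ xs → v ∈ₗ xs′
        only   : ∀ {v} → v ∈ₗ xs′ → v ≡ z ⊎ v ∈ₗ xs
        tags⊆  : ∀ {τ} → τ ∈ₗ ts → τ ∈ₗ ts′

    -- The tag of the edge lies in `z` and in both ends of the edge, so both new edges inherit it.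
    -- No tag is lost, and later insertions remain possible.
    insert : ∀ {z y xs ts} → Chain y xs ts → Any (z ∋_) ts → z ∉ₗ xs → Inserted z y xs ts
    insert {z} {y} (link {xs = xs} c x∋ y∋ y∉) (here z∋) z∉ = record
      { chain′ = link (link c x∋ z∋ (z∉ ∘ there)) z∋ y∋
                      (λ { (here refl) → z∉ (here refl) ; (there y∈) → y∉ y∈ })
      ; new = there (here refl)
      ; old = λ { (here refl) → here refl ; (there v∈) → there (there v∈) }
      ; only = λ { (here refl) → inj₂ (here refl) ; (there (here refl)) → inj₁ refl
                 ; (there (there v∈)) → inj₂ (there v∈) }
      ; tags⊆ = λ { (here refl) → here refl ; (there τ∈) → there (there τ∈) } }
    insert {z} {y} (link {xs = xs} c x∋ y∋ y∉) (there z∋) z∉ = record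
      { chain′ = link chain′ x∋ y∋ (λ y∈ → [ (λ { refl → z∉ (here refl) }) , y∉ ]′ (only y∈))
      ; new = there new
      ; old = λ { (here refl) → here refl ; (there v∈) → there (old v∈) }
      ; only = λ { (here refl) → inj₂ (here refl)
                 ; (there v∈) → [ inj₁ , (λ v∈xs → inj₂ (there v∈xs)) ]′ (only v∈) }
      ; tags⊆ = λ { (here refl) → here refl ; (there τ∈) → there (tags⊆ τ∈) } }
      where open Inserted (insert c z∋ (z∉ ∘ there))

    chain⇒path : ∀ {x xs ts} → Chain x xs ts →
      Σ (Path G u₁ x) λ P → ∀ v → v ∈ₗ verts P ⇔ v ∈ₗ xs
    chain⇒path root = record
      { verts = [ u₁ ] ; start = refl ; end = refl ; simple = [] ∷ [] ; linked = [-] } , λ v → mk⇔ id id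
    chain⇒path (link {x} {y} {xs} c x∋ y∋ y∉) with P , P⇔ ← chain⇒path c = record
      { verts = verts P ++ [ y ]
      ; start = head-++ (verts P) (start P)
      ; end = last-++ (verts P)
      ; simple = Uniqueₚ.++⁺ (simple P) ([] ∷ []) (λ { (v∈ , here refl) → y∉ (Equivalence.to (P⇔ y) v∈) })
      ; linked = Linkedₚ.++⁺ (linked P)
          (subst (λ l → Connected (Adj G) l (just y)) (≡-sym (end P))
            (just (∋⇒adj (λ { refl → y∉ (chain-end∈ c) }) x∋ y∋))) [-]
      } , λ v → mk⇔
        (λ v∈ → case Mₚ.∈-++⁻ (verts P) v∈ of λ
          { (inj₁ v∈P) → there (Equivalence.to (P⇔ v) v∈P) ; (inj₂ (here refl)) → here refl })
        (λ { (here refl) → Mₚ.∈-++⁺ʳ (verts P) (here refl)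
           ; (there v∈) → Mₚ.∈-++⁺ˡ (Equivalence.from (P⇔ v) v∈) })
      where
      head-++ : ∀ {A : Set} {x y : A} xs → head xs ≡ just x → head (xs ++ [ y ]) ≡ just x
      head-++ (_ ∷ _) eq = eq
      last-++ : ∀ {A : Set} {y : A} xs → last (xs ++ [ y ]) ≡ just y
      last-++ [] = refl
      last-++ (_ ∷ []) = refl
      last-++ (_ ∷ x ∷ xs) = last-++ (x ∷ xs)

    record Track : Set where
      constructor track
      field
        {stop}  : V
        {trail} : List V
        {tags}  : List ℕ
        chain   : Chain stop trail tags
    open Track

    -- Sufficiency: the sweep

    module Sufficiency (p′ : ℕ) (scat : ScatLe G ((+ 2) - (+ suc p′))) where

      p : ℕ
      p = suc p′

      -- Deleting the vertices that cross `gaps` separates the sides and `uₙ` from each other, which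
      -- gives at least `suc (length sides)` components. At most `length others + length L` vertices
      -- are deleted.
      bottleneck-width : ∀ {N g} → Bottleneck N g → g < s → (L : List V) →
        (∀ {v} → N v → Cross g v → v ∈ₗ L) → p ≤ length L
      bottleneck-width {N} {g} B g<s L N⊆L =
        ℕₚ.+-cancelʳ-≤ (suc (length sides)) p (length L) (begin
          p + suc (length sides)              ≤⟨ ℕₚ.+-monoʳ-≤ p sides<k ⟩
          p + k                               ≤⟨ -‿≤⇒+≤ k ∣ S ∣ p (scat S k cs 2≤k) ⟩
          2 + ∣ S ∣                           ≤⟨ s≤s (s≤s (∣∣≤length S (others ++ L) S⊆)) ⟩
          2 + length (others ++ L)            ≡⟨ cong (λ m → 2 + m) (Lₚ.length-++ others) ⟩
          2 + (length others + length L)      ≤⟨ s≤s (ℕₚ.+-monoˡ-≤ (length L) few) ⟩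
          suc (length sides) + length L       ≡⟨ ℕₚ.+-comm (suc (length sides)) (length L) ⟩
          length L + suc (length sides)       ∎)
        where
        open Bottleneck B
        open ℕₚ.≤-Reasoning
        S : Subset (n G)
        S = ⟦ crossed? gaps ⟧
        open Separation S
        k : ℕ
        k = proj₁ components
        cs : NumComponents G S k
        cs = proj₂ components
        g<a[uₙ] : g < a uₙ
        g<a[uₙ] = <-≤-trans g<s (≤-reflexive (≡-sym a[uₙ]≡s))
        witness : ∀ {ℓ} → ℓ ∈ₗ map label (uₙ ∷ sides) → ∃ λ v → v ∉ S × label v ≡ ℓ
        witness ℓ∈ with Mₚ.∈-map⁻ label ℓ∈
        ... | v , here refl , eq = v , beyond⇒¬crossed zigzag g<a[uₙ] ∘ ∈⟦⟧⁻ (crossed? gaps) , ≡-sym eq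
        ... | v , there v∈ , eq = v , zigzag-¬crossed zigzag v∈ ∘ ∈⟦⟧⁻ (crossed? gaps) , ≡-sym eq
        sides<k : length sides < k
        sides<k = subst (_≤ k) (Lₚ.length-map label (uₙ ∷ sides))
          (labels≤components cs (map label (uₙ ∷ sides))
            (zigzag-labels zigzag (λ e∈ v c → ∈⟦⟧⁺ (crossed? gaps) (lose e∈ c)) g<a[uₙ]) witness)
        2≤k : 2 ≤ k
        2≤k = ≤-trans (s≤s (≤-trans (s≤s z≤n) few)) sides<k
        S⊆ : ∀ v → v ∈ S → v ∈ₗ others ++ L
        S⊆ v v∈ with cover v (∈⟦⟧⁻ (crossed? gaps) v∈)
        ... | inj₁ v∈others = Mₚ.∈-++⁺ˡ v∈others
        ... | inj₂ (Nv , c) = Mₚ.∈-++⁺ʳ others (N⊆L Nv c)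

      Alive : List V → (Fin p → Track) → V → Set
      Alive free tracks v = v ∈ₗ free ⊎ ∃ λ j → stop (tracks j) ≡ v

      -- The sweep has reached the point now, and some track was last extended at the point t.
      record State (now : ℕ) (free : List V) : Set where
        field
          tracks   : Fin p → Track
          t        : ℕ
          t≤now    : t ≤ now
          disjoint : ∀ i j {v} → v ∈ₗ trail (tracks i) → v ∈ₗ trail (tracks j) → i ≡ j ⊎ v ≡ u₁
          fresh    : ∀ {v} → v ∈ₗ free → ∀ j → v ∉ₗ trail (tracks j)
          covered  : ∀ v → v ∈ₗ free ⊎ ∃ λ j → v ∈ₗ trail (tracks j)
          early    : ∀ {v} j → v ∈ₗ trail (tracks j) → a v ≤ t
          lasting  : ∀ j → now ≤ b (stop (tracks j))
          -- The last extension took the free vertex ending first; before any extension, `u₁` ends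
          -- at `0`.
          queued   : ∀ {z} → z ∈ₗ free → Cross t z → ∃ λ j → b (stop (tracks j)) ≤ b z
          -- The alternative `a z ≤ 0` stands for the tag `0`, which a track carries only once it
          -- has left `u₁`.
          hit      : ∀ {z} → z ∈ₗ free → b z < now ⊎ a z ≤ t →
                     a z ≤ 0 ⊎ ∃ λ j → Any (z ∋_) (tags (tracks j))
          -- By `bottleneck-width`, at least `p` alive vertices cross every gap ahead.
          narrow   : ∀ g → t ≤ g → g < s → Bottleneck (Alive free tracks) g
          uₙ-free  : uₙ ∈ₗ free

      without : V → List V → List V
      without v = filter (λ w → ¬? (w F.≟ v))

      ∈-without⁻ : ∀ {v w} xs → w ∈ₗ without v xs → w ∈ₗ xs × w ≢ v
      ∈-without⁻ {v} xs = Mₚ.∈-filter⁻ (λ w → ¬? (w F.≟ v)) {xs = xs}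

      ∈-without⁺ : ∀ {v w xs} → w ∈ₗ xs → w ≢ v → w ∈ₗ without v xs
      ∈-without⁺ {v} = Mₚ.∈-filter⁺ (λ w → ¬? (w F.≟ v))

      initial : State 0 (without u₁ (allFin (n G)))
      initial = record
        { tracks = λ _ → track root
        ; t = 0
        ; t≤now = z≤n
        ; disjoint = λ { i j (here refl) _ → inj₂ refl }
        ; fresh = λ { v∈ j (here refl) → proj₂ (∈-without⁻ (allFin (n G)) v∈) refl }
        ; covered = covered
        ; early = λ { j (here refl) → ≤-reflexive a[u₁]≡0 }
        ; lasting = λ _ → z≤n
        ; queued = λ _ _ → zero , ≤-trans (≤-reflexive b[u₁]≡0) z≤n
        ; hit = λ { _ (inj₂ a≤0) → inj₁ a≤0 }
        ; narrow = λ g _ _ → record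
            { zigzag = base ; others = [] ; few = s≤s z≤n
            ; cover = λ { v (here c) → inj₂ (alive v , c) } }
        ; uₙ-free = ∈-without⁺ (Mₚ.∈-allFin uₙ) (u₁≢uₙ ∘ ≡-sym)
        }
        where
        covered : ∀ v → v ∈ₗ without u₁ (allFin (n G)) ⊎ ∃ λ (j : Fin p) → v ∈ₗ [ u₁ ]
        covered v with v F.≟ u₁
        ... | yes refl = inj₂ (zero , here refl)
        ... | no v≢ = inj₁ (∈-without⁺ (Mₚ.∈-allFin v) v≢)
        alive : ∀ v → Alive (without u₁ (allFin (n G))) (λ _ → track root) v
        alive v with v F.≟ u₁
        ... | yes refl = inj₂ (zero , refl)
        ... | no v≢ = inj₁ (∈-without⁺ (Mₚ.∈-allFin v) v≢)

      -- At `now` the track `j₀` gives up its last vertex. By `urgent`, either that vertex ends here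
      -- and crosses no gap ahead, or a free vertex beginning after `t` ends here, so that a zigzag
      -- can gain a side.
      module Switch {now free} (st : State now free) (now<s : now < s) (j₀ : Fin p)
        (first : ∀ j → b (stop (State.tracks st j₀)) ≤ b (stop (State.tracks st j)))
        (urgent : b (stop (State.tracks st j₀)) ≡ now ⊎
                  ∃ λ z → z ∈ₗ free × State.t st < a z × b z ≡ now) where
        open State st

        x : V
        x = stop (tracks j₀)

        Alive′ : V → Set
        Alive′ v = v ∈ₗ free ⊎ ∃ λ j → j ≢ j₀ × stop (tracks j) ≡ v

        alive′ : ∀ {v} → v ≢ x → Alive free tracks v → Alive′ v
        alive′ v≢x (inj₁ v∈) = inj₁ v∈
        alive′ v≢x (inj₂ (j , refl)) = inj₂ (j , (λ { refl → v≢x refl }) , refl)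

        -- The dropped x reaches beyond g, so every track does, and so does every free vertex crossing
        -- e: it is queued behind a track, or else it begins after t and before the leftmost z that
        -- ends by g. Hence x is the only vertex that the bottleneck at e loses on the way to g, and
        -- z makes up for it.
        module Widen {g : ℕ} (now≤g : now ≤ g) (g<s : g < s) (g<b[x] : g < b x)
          {z₀ : V} (z₀∈ : z₀ ∈ₗ free) (t<z₀ : t < a z₀) (z₀≡ : b z₀ ≡ now) where

          inner? : Decidable (λ z → t < a z × b z ≤ g)
          inner? z = (t ℕ.<? a z) ×-dec (b z ℕ.≤? g)

          leftmost : ∃ λ z → z ∈ₗ filter inner? free × (∀ {w} → w ∈ₗ filter inner? free → a z ≤ a w)
          leftmost = least a (Mₚ.∈-filter⁺ inner? z₀∈ (t<z₀ , ≤-trans (≤-reflexive z₀≡) now≤g))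

          z : V
          z = proj₁ leftmost

          t<a[z] : t < a z
          t<a[z] = proj₁ (proj₂ (Mₚ.∈-filter⁻ inner? {xs = free} (proj₁ (proj₂ leftmost))))

          b[z]≤g : b z ≤ g
          b[z]≤g = proj₂ (proj₂ (Mₚ.∈-filter⁻ inner? {xs = free} (proj₁ (proj₂ leftmost))))

          e : ℕ
          -- The gap immediately left of `z`. From `t < a z` the predecessor is genuine and `t ≤ e`,
          -- so `narrow` applies at `e`.
          e = pred (a z)

          suc-e : suc e ≡ a z
          suc-e = ℕₚ.suc-pred (a z) {{ℕ.>-nonZero (≤-<-trans z≤n t<a[z])}}

          t≤e : t ≤ e
          t≤e = s≤s⁻¹ (≤-trans t<a[z] (≤-reflexive (≡-sym suc-e)))

          e<g : e < g
          e<g = ≤-trans (≤-reflexive suc-e) (≤-trans (a≤b z) b[z]≤g)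

          alive⇒long : ∀ {v} → Alive free tracks v → Cross e v → g < b v
          alive⇒long (inj₂ (j , refl)) _ = <-≤-trans g<b[x] (first j)
          alive⇒long {v} (inj₁ v∈) (a≤e , e<b) with a v ℕ.≤? t
          ... | yes a≤t with j , j≤v ← queued v∈ (a≤t , ≤-<-trans t≤e e<b) =
            <-≤-trans g<b[x] (≤-trans (first j) j≤v)
          ... | no a≰t with b v ℕ.≤? g
          ...   | no b≰g = ≰⇒> b≰g
          ...   | yes b≤g = contradiction (≤-trans (≤-reflexive suc-e)
                    (≤-trans (proj₂ (proj₂ leftmost) (Mₚ.∈-filter⁺ inner? v∈ (≰⇒> a≰t , b≤g))) a≤e))
                    ℕₚ.1+n≰n

          open Bottleneck (narrow e t≤e (ℕₚ.<-trans e<g g<s))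

          old : ∀ v → Crossed gaps v → v ∈ₗ x ∷ others ⊎ (Alive′ v × Cross g v)
          old v c with cover v c | v F.≟ x
          ... | inj₁ v∈ | _ = inj₁ (there v∈)
          ... | inj₂ _ | yes v≡x = inj₁ (here v≡x)
          ... | inj₂ (al , c′) | no v≢x =
            inj₂ (alive′ v≢x al , ≤-trans (proj₁ c′) (<⇒≤ e<g) , alive⇒long al c′)

          new : ∀ v → Cross g v → v ∈ₗ x ∷ others ⊎ (Alive′ v × Cross g v)
          new v c with covered v
          ... | inj₁ v∈ = inj₂ (inj₁ v∈ , c)
          -- A vertex on a track begins by `t`, hence by `e`; as it crosses `g`, it crosses `e` as
          -- well.
          ... | inj₂ (j , v∈) =
            old v (lose (zigzag-last zigzag) (≤-trans (early j v∈) t≤e , ℕₚ.<-trans e<g (proj₂ c)))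

          widened : Bottleneck Alive′ g
          widened = record
            { zigzag = turn zigzag (≤-reflexive suc-e) b[z]≤g
            ; others = x ∷ others
            ; few = s≤s few
            ; cover = λ { v (here c) → new v c ; v (there c) → old v c } }

        -- If `x` ends by `g`, it does not cross that gap and the old bottleneck does without it.
        -- Otherwise `x` does not end at `now`, and `urgent` supplies the free vertex that `Widen`
        -- needs.
        drop : ∀ g → now ≤ g → g < s → Bottleneck Alive′ g
        drop g now≤g g<s with b x ℕ.≤? g
        ... | yes b≤g = Bottleneck-map
              (λ { (_ , g<b) → alive′ (λ { refl → <⇒≱ g<b b≤g }) })
              (narrow g (≤-trans t≤now now≤g) g<s)
        ... | no b≰g =
              [ (λ b≡now → contradiction (≤-trans (≤-reflexive b≡now) now≤g) b≰g)
              , (λ { (z , z∈ , t<a , b≡now) → Widen.widened now≤g g<s (≰⇒> b≰g) z∈ t<a b≡now }) ]′ urgent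

        other? : Decidable (_≢ j₀)
        other? j = ¬? (j F.≟ j₀)

        -- Otherwise the vertices counted by the bottleneck at `now` would be among the last
        -- vertices of the other `p - 1` tracks, while at least `p` are required.
        replaceable : Any (Cross now) free
        replaceable with any? (cross? now) free
        ... | yes c = c
        ... | no ¬c = contradiction
          (bottleneck-width (drop now ≤-refl now<s) now<s (map (stop ∘ tracks) others)
            λ { (inj₁ v∈) c → contradiction (lose v∈ c) ¬c
              ; (inj₂ (j , j≢ , refl)) _ →
                  Mₚ.∈-map⁺ (stop ∘ tracks) (Mₚ.∈-filter⁺ other? (Mₚ.∈-allFin j) j≢) })
          (<⇒≱ (subst₂ _<_ (≡-sym (Lₚ.length-map (stop ∘ tracks) others)) (Lₚ.length-tabulate {n = p} id)
            (Lₚ.filter-notAll other? (allFin p) (lose (Mₚ.∈-allFin j₀) (λ j≢ → j≢ refl)))))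
          where
          others : List (Fin p)
          others = filter other? (allFin p)

        -- Choosing the earliest end re-establishes `queued` when `t` becomes `now`.
        next : ∃ λ y → y ∈ₗ filter (cross? now) free × (∀ {w} → w ∈ₗ filter (cross? now) free → b y ≤ b w)
        next with w , w∈ , c ← find replaceable = least b (Mₚ.∈-filter⁺ (cross? now) w∈ c)

        y : V
        y = proj₁ next

        y∈ : y ∈ₗ free
        y∈ = proj₁ (Mₚ.∈-filter⁻ (cross? now) {xs = free} (proj₁ (proj₂ next)))

        y-cross : Cross now y
        y-cross = proj₂ (Mₚ.∈-filter⁻ (cross? now) {xs = free} (proj₁ (proj₂ next)))

        extended : Track
        extended = track (link (chain (tracks j₀))
          (≤-trans (early j₀ (chain-end∈ (chain (tracks j₀)))) t≤now , lasting j₀)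
          (proj₁ y-cross , <⇒≤ (proj₂ y-cross)) (fresh y∈ j₀))

        tracks′ : Fin p → Track
        tracks′ = updateAt tracks j₀ (λ _ → extended)

        tracks′-elim : (Q : Fin p → Track → Set) → Q j₀ extended → (∀ j → j ≢ j₀ → Q j (tracks j)) →
          ∀ j → Q j (tracks′ j)
        tracks′-elim = updateAt-elim tracks j₀ extended

        trail′⁻ : ∀ {v} j → v ∈ₗ trail (tracks′ j) → v ∈ₗ trail (tracks j) ⊎ (j ≡ j₀ × v ≡ y)
        trail′⁻ {v} = tracks′-elim (λ j tr → v ∈ₗ trail tr → v ∈ₗ trail (tracks j) ⊎ (j ≡ j₀ × v ≡ y))
          (λ { (here refl) → inj₂ (refl , refl) ; (there v∈) → inj₁ v∈ }) (λ _ _ → inj₁)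

        trail′⁺ : ∀ {v} j → v ∈ₗ trail (tracks j) → v ∈ₗ trail (tracks′ j)
        trail′⁺ {v} = tracks′-elim (λ j tr → v ∈ₗ trail (tracks j) → v ∈ₗ trail tr) there (λ _ _ → id)

        free′ : List V
        free′ = without y free

        switched : State now free′
        switched = record
          { tracks = tracks′
          ; t = now
          ; t≤now = ≤-refl
          ; disjoint = disjoint′
          ; fresh = fresh′
          ; covered = covered′
          ; early = λ j v∈ →
              [ (λ v∈ → ≤-trans (early j v∈) t≤now) , (λ { (_ , refl) → proj₁ y-cross }) ]′ (trail′⁻ j v∈)
          ; lasting = tracks′-elim (λ _ tr → now ≤ b (stop tr)) (<⇒≤ (proj₂ y-cross)) (λ j _ → lasting j)
          ; queued = λ {z} z∈ c → j₀ , tracks′-elim (λ j tr → j ≡ j₀ → b (stop tr) ≤ b z)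
              (λ _ → proj₂ (proj₂ next) (Mₚ.∈-filter⁺ (cross? now) (proj₁ (∈-without⁻ free z∈)) c))
              (λ j j≢ j≡ → contradiction j≡ j≢) j₀ refl
          ; hit = λ {z} z∈ → hit′ (proj₁ (∈-without⁻ free z∈))
          ; narrow = λ g now≤g g<s → Bottleneck-map (λ _ → alive″) (drop g now≤g g<s)
          ; uₙ-free = ∈-without⁺ uₙ-free (λ uₙ≡y → ¬cross-uₙ (subst (Cross now) (≡-sym uₙ≡y) y-cross))
          }
          where
          disjoint′ : ∀ i j {v} → v ∈ₗ trail (tracks′ i) → v ∈ₗ trail (tracks′ j) → i ≡ j ⊎ v ≡ u₁
          disjoint′ i j v∈i v∈j with trail′⁻ i v∈i | trail′⁻ j v∈j
          ... | inj₁ v∈ | inj₁ v∈′ = disjoint i j v∈ v∈′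
          ... | inj₁ v∈ | inj₂ (_ , refl) = contradiction v∈ (fresh y∈ i)
          ... | inj₂ (_ , refl) | inj₁ v∈ = contradiction v∈ (fresh y∈ j)
          ... | inj₂ (refl , _) | inj₂ (refl , _) = inj₁ refl

          fresh′ : ∀ {v} → v ∈ₗ free′ → ∀ j → v ∉ₗ trail (tracks′ j)
          fresh′ v∈ j v∈j with ∈-without⁻ free v∈ | trail′⁻ j v∈j
          ... | v∈free , _ | inj₁ v∈j = fresh v∈free j v∈j
          ... | _ , v≢y | inj₂ (_ , v≡y) = v≢y v≡y

          covered′ : ∀ v → v ∈ₗ free′ ⊎ ∃ λ j → v ∈ₗ trail (tracks′ j)
          covered′ v with covered v | v F.≟ y
          ... | inj₂ (j , v∈) | _ = inj₂ (j , trail′⁺ j v∈)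
          ... | inj₁ v∈ | no v≢ = inj₁ (∈-without⁺ v∈ v≢)
          ... | inj₁ v∈ | yes refl = inj₂ (j₀ , tracks′-elim (λ j tr → j ≡ j₀ → y ∈ₗ trail tr)
                  (λ _ → here refl) (λ j j≢ j≡ → contradiction j≡ j≢) j₀ refl)

          hit-old : ∀ {z} → a z ≤ 0 ⊎ (∃ λ j → Any (z ∋_) (tags (tracks j))) →
            a z ≤ 0 ⊎ ∃ λ j → Any (z ∋_) (tags (tracks′ j))
          hit-old (inj₁ a≤0) = inj₁ a≤0
          hit-old {z} (inj₂ (j , ∋τ)) = inj₂ (j ,
            tracks′-elim (λ j tr → Any (z ∋_) (tags (tracks j)) → Any (z ∋_) (tags tr))
              there (λ _ _ → id) j ∋τ)

          hit′ : ∀ {z} → z ∈ₗ free → b z < now ⊎ a z ≤ now →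
            a z ≤ 0 ⊎ ∃ λ j → Any (z ∋_) (tags (tracks′ j))
          hit′ z∈ (inj₁ b<now) = hit-old (hit z∈ (inj₁ b<now))
          hit′ {z} z∈ (inj₂ a≤now) with b z ℕ.<? now
          ... | yes b<now = hit-old (hit z∈ (inj₁ b<now))
          -- Having begun by `now` and not ended before it, `z` contains the new tag `now`.
          ... | no b≮now = inj₂ (j₀ , tracks′-elim (λ j tr → j ≡ j₀ → Any (z ∋_) (tags tr))
                  (λ _ → here (a≤now , ≮⇒≥ b≮now)) (λ j j≢ j≡ → contradiction j≡ j≢) j₀ refl)

          alive″ : ∀ {v} → Alive′ v → Alive free′ tracks′ v
          alive″ {v} (inj₁ v∈) with v F.≟ y
          ... | no v≢ = inj₁ (∈-without⁺ v∈ v≢)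
          ... | yes refl = inj₂ (j₀ , cong stop (VFₚ.updateAt-updates j₀ tracks))
          alive″ (inj₂ (j , j≢ , refl)) = inj₂ (j , cong stop (VFₚ.updateAt-minimal j j₀ tracks j≢))

        shrinks : length free′ < length free
        shrinks = Lₚ.filter-notAll (λ w → ¬? (w F.≟ y)) free (lose y∈ (λ y≢ → y≢ refl))

      -- Besides `lasting`, renewed by `crossing`, only `hit` is at stake. A free vertex ending at
      -- `now` begins by `t`, where the old `hit` covers it, since otherwise it would be urgent.
      advance : ∀ {now free} (st : State now free) →
        (∀ j → now < b (stop (State.tracks st j))) →
        ¬ Any (λ z → State.t st < a z × b z ≡ now) free → State (suc now) free
      advance {now} {free} st crossing ¬urgent = record
        { tracks = tracks ; t = t ; t≤now = ℕₚ.m≤n⇒m≤1+n t≤now ; disjoint = disjoint ; fresh = fresh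
        ; covered = covered ; early = early ; lasting = crossing ; queued = queued ; hit = hit′
        ; narrow = narrow ; uₙ-free = uₙ-free }
        where
        open State st
        hit′ : ∀ {z} → z ∈ₗ free → b z < suc now ⊎ a z ≤ t →
          a z ≤ 0 ⊎ ∃ λ j → Any (z ∋_) (tags (tracks j))
        hit′ z∈ (inj₂ a≤t) = hit z∈ (inj₂ a≤t)
        hit′ {z} z∈ (inj₁ (s≤s b≤now)) with a z ℕ.≤? t | b z ℕ.≟ now
        ... | yes a≤t | _ = hit z∈ (inj₂ a≤t)
        ... | no _ | no b≢ = hit z∈ (inj₁ (ℕₚ.≤∧≢⇒< b≤now b≢))
        ... | no a≰t | yes b≡ = contradiction (lose z∈ (≰⇒> a≰t , b≡)) ¬urgent

      -- The fuel bounds the points ahead plus the free vertices: an extension uses up a free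
      -- vertex, a move to the next point uses up a point.
      sweep : ∀ fuel {now free} → State now free → now ≤ s → (s ∸ now) + length free ≤ fuel →
        ∃ (State s)
      sweep fuel {now} {free} st now≤s enough with now ℕ.≟ s
      ... | yes refl = free , st
      ... | no now≢s with ℕₚ.≤∧≢⇒< now≤s now≢s | fuel
      ...   | now<s | zero = contradiction (≤-trans (ℕₚ.m≤m+n (s ∸ now) (length free)) enough)
                               (<⇒≱ (ℕₚ.m<n⇒0<n∸m now<s))
      ...   | now<s | suc fuel
        with j₀ , _ , first ← least (b ∘ stop ∘ State.tracks st) (Mₚ.∈-allFin {n = p} zero)
        with b (stop (State.tracks st j₀)) ℕ.≟ now
           | any? (λ z → (State.t st ℕ.<? a z) ×-dec (b z ℕ.≟ now)) free
      ... | yes b≡now | _ = sweep fuel switched now≤s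
              (s≤s⁻¹ (≤-trans (≤-reflexive (≡-sym (ℕₚ.+-suc (s ∸ now) (length free′))))
                (≤-trans (ℕₚ.+-monoʳ-≤ (s ∸ now) shrinks) enough)))
        where open Switch st now<s j₀ (λ j → first (Mₚ.∈-allFin j)) (inj₁ b≡now)
      ... | no _ | yes urgent = sweep fuel switched now≤s
              (s≤s⁻¹ (≤-trans (≤-reflexive (≡-sym (ℕₚ.+-suc (s ∸ now) (length free′))))
                (≤-trans (ℕₚ.+-monoʳ-≤ (s ∸ now) shrinks) enough)))
        where open Switch st now<s j₀ (λ j → first (Mₚ.∈-allFin j)) (inj₂ (find urgent))
      ... | no b≢now | no ¬urgent = sweep fuel
              (advance st (λ j → <-≤-trans (ℕₚ.≤∧≢⇒< (State.lasting st j₀) (b≢now ∘ ≡-sym))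
                                   (first (Mₚ.∈-allFin j))) ¬urgent)
              now<s
              (s≤s⁻¹ (≤-trans (ℕₚ.+-monoˡ-≤ (length free) (ℕₚ.∸-monoʳ-< ≤-refl now<s)) enough))

      -- Closing the tracks and inserting the remaining vertices

      record Weave (free : List V) : Set where
        field
          threads  : Fin p → Track
          stops    : ∀ j → stop (threads j) ≡ uₙ
          disjoint : ∀ i j {v} → v ∈ₗ trail (threads i) → v ∈ₗ trail (threads j) → i ≡ j ⊎ (v ≡ u₁ ⊎ v ≡ uₙ)
          covered  : ∀ v → v ∈ₗ free ⊎ ∃ λ j → v ∈ₗ trail (threads j)
          hit      : ∀ {z} → z ∈ₗ free → ∃ λ j → Any (z ∋_) (tags (threads j))

      -- All tracks reach the point `s`, where each is extended by `uₙ`. The new tag `s` serves the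
      -- free vertices that end at `s`.
      close : ∀ {free} → State s free → Weave (without uₙ free)
      close {free} st = record
        { threads = threads ; stops = λ _ → refl ; disjoint = disjoint′ ; covered = covered′
        ; hit = λ z∈ → hit′ (proj₁ (∈-without⁻ free z∈)) }
        where
        open State st
        threads : Fin p → Track
        threads j = track (link (chain (tracks j))
          (≤-trans (early j (chain-end∈ (chain (tracks j)))) t≤now , lasting j)
          (≤-reflexive a[uₙ]≡s , ≤-trans (≤-reflexive (≡-sym a[uₙ]≡s)) (a≤b uₙ)) (fresh uₙ-free j))

        disjoint′ : ∀ i j {v} → v ∈ₗ trail (threads i) → v ∈ₗ trail (threads j) → i ≡ j ⊎ (v ≡ u₁ ⊎ v ≡ uₙ)
        disjoint′ i j (here refl) _ = inj₂ (inj₂ refl)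
        disjoint′ i j (there _) (here refl) = inj₂ (inj₂ refl)
        disjoint′ i j (there v∈) (there v∈′) = [ inj₁ , inj₂ ∘ inj₁ ]′ (disjoint i j v∈ v∈′)

        covered′ : ∀ v → v ∈ₗ without uₙ free ⊎ ∃ λ j → v ∈ₗ trail (threads j)
        covered′ v with covered v | v F.≟ uₙ
        ... | inj₂ (j , v∈) | _ = inj₂ (j , there v∈)
        ... | inj₁ v∈ | no v≢ = inj₁ (∈-without⁺ v∈ v≢)
        ... | inj₁ _ | yes refl = inj₂ (zero , here refl)

        hit′ : ∀ {z} → z ∈ₗ free → ∃ λ j → Any (z ∋_) (tags (threads j))
        hit′ {z} z∈ with b z ℕ.<? s
        ... | no b≮s = zero , here (≤-trans (a≤b z) (b≤s z) , ≮⇒≥ b≮s)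
        ... | yes b<s with hit z∈ (inj₁ b<s)
        ...   | inj₁ a≤0 = zero , lose (chain-tag-0 (chain (threads zero)) (u₁≢uₙ ∘ ≡-sym)) (a≤0 , z≤n)
        ...   | inj₂ (j , ∋τ) = j , there ∋τ

      module Insert {z free} (W : Weave (z ∷ free)) (z∉ : ∀ j → z ∉ₗ trail (Weave.threads W j)) where
        open Weave W

        j₀ : Fin p
        j₀ = proj₁ (hit (here refl))

        open Inserted (insert (chain (threads j₀)) (proj₂ (hit (here refl))) (z∉ j₀))

        threads′ : Fin p → Track
        threads′ = updateAt threads j₀ (λ _ → track chain′)

        threads′-elim : (Q : Fin p → Track → Set) → Q j₀ (track chain′) → (∀ j → j ≢ j₀ → Q j (threads j)) →
          ∀ j → Q j (threads′ j)
        threads′-elim = updateAt-elim threads j₀ (track chain′)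

        trail′⁻ : ∀ {v} j → v ∈ₗ trail (threads′ j) → v ∈ₗ trail (threads j) ⊎ (j ≡ j₀ × v ≡ z)
        trail′⁻ {v} = threads′-elim (λ j tr → v ∈ₗ trail tr → v ∈ₗ trail (threads j) ⊎ (j ≡ j₀ × v ≡ z))
          (λ v∈ → [ (λ v≡z → inj₂ (refl , v≡z)) , inj₁ ]′ (only v∈)) (λ _ _ → inj₁)

        inserted : Weave free
        inserted = record
          { threads = threads′
          ; stops = threads′-elim (λ _ tr → stop tr ≡ uₙ) (stops j₀) (λ j _ → stops j)
          ; disjoint = disjoint′
          ; covered = covered′
          ; hit = λ {w} w∈ → map₂ (λ {j} → threads′-elim
              (λ j tr → Any (w ∋_) (tags (threads j)) → Any (w ∋_) (tags tr))
              (λ ∋τ → let τ , τ∈ , w∋ = find ∋τ in lose (tags⊆ τ∈) w∋) (λ _ _ → id) j) (hit (there w∈))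
          }
          where
          disjoint′ : ∀ i j {v} → v ∈ₗ trail (threads′ i) → v ∈ₗ trail (threads′ j) → i ≡ j ⊎ (v ≡ u₁ ⊎ v ≡ uₙ)
          disjoint′ i j v∈i v∈j with trail′⁻ i v∈i | trail′⁻ j v∈j
          ... | inj₁ v∈ | inj₁ v∈′ = disjoint i j v∈ v∈′
          ... | inj₁ v∈ | inj₂ (_ , refl) = contradiction v∈ (z∉ i)
          ... | inj₂ (_ , refl) | inj₁ v∈ = contradiction v∈ (z∉ j)
          ... | inj₂ (refl , _) | inj₂ (refl , _) = inj₁ refl

          covered′ : ∀ v → v ∈ₗ free ⊎ ∃ λ j → v ∈ₗ trail (threads′ j)
          covered′ v with covered v
          ... | inj₁ (there v∈) = inj₁ v∈
          ... | inj₁ (here refl) = inj₂ (j₀ , threads′-elim (λ j tr → j ≡ j₀ → z ∈ₗ trail tr)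
                  (λ _ → new) (λ j j≢ j≡ → contradiction j≡ j≢) j₀ refl)
          ... | inj₂ (j , v∈) = inj₂ (j ,
                  threads′-elim (λ j tr → v ∈ₗ trail (threads j) → v ∈ₗ trail tr) old (λ _ _ → id) j v∈)

      weave : ∀ free → Weave free → Weave []
      weave [] W = W
      weave (z ∷ free) W with Fₚ.any? (λ j → any? (z F.≟_) (trail (Weave.threads W j)))
      ... | no z∉ = weave free (Insert.inserted W (λ j z∈ → z∉ (j , z∈)))
      -- A `Weave` does not record that the entries of `free` are distinct or off the threads; a `z`
      -- already on a thread is skipped.
      ... | yes z∈ = weave free record
              { threads = threads ; stops = stops ; disjoint = disjoint ; covered = covered′
              ; hit = hit ∘ there }
        where
        open Weave W
        covered′ : ∀ v → v ∈ₗ free ⊎ ∃ λ j → v ∈ₗ trail (threads j)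
        covered′ v with covered v
        ... | inj₁ (here refl) = inj₂ z∈
        ... | inj₁ (there v∈) = inj₁ v∈
        ... | inj₂ v∈ = inj₂ v∈

      scat⇒stave : SpanningStave G p u₁ uₙ
      scat⇒stave = (λ j → proj₁ (paths j)) ,
        (λ i j i≢j w w∈i w∈j → [ (λ i≡j → contradiction i≡j i≢j) , id ]′
          (disjoint i j (Equivalence.to (proj₂ (paths i) w) w∈i) (Equivalence.to (proj₂ (paths j) w) w∈j))) ,
        spanning
        where
        open Weave (weave _ (close (proj₂ (sweep _ initial z≤n ≤-refl))))
        paths : ∀ j → Σ (Path G u₁ uₙ) λ P → ∀ v → v ∈ₗ verts P ⇔ v ∈ₗ trail (threads j)
        paths j = subst (λ x → Σ (Path G u₁ x) λ P → ∀ v → v ∈ₗ verts P ⇔ v ∈ₗ trail (threads j))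
          (stops j) (chain⇒path (chain (threads j)))
        spanning : ∀ w → ∃ λ j → w ∈ₗ verts (proj₁ (paths j))
        spanning w with covered w
        ... | inj₂ (j , w∈) = j , Equivalence.from (proj₂ (paths j) w) w∈

-- The interval model of a clique path

module CliquePath (G : Graph) {s : ℕ} {C : Fin (suc s) → Subset (n G)}
  (cliquePath : IsCliquePath G (suc s) C) where

  maximal : ∀ i → IsMaximalClique G (C i)
  maximal = proj₁ cliquePath

  complete : ∀ K → IsMaximalClique G K → ∃ λ i → C i ≡ K
  complete = proj₁ (proj₂ (proj₂ cliquePath))

  edge : ∀ u v → Adj G u v → ∃ λ i → u ∈ C i × v ∈ C i
  edge = proj₁ (proj₂ (proj₂ (proj₂ cliquePath)))

  convex : ∀ v i j k → i F.≤ j → j F.≤ k → v ∈ C i → v ∈ C k → v ∈ C j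
  convex = proj₂ (proj₂ (proj₂ (proj₂ cliquePath)))

  -- A vertex in none of the C i would be isolated, so that it would be a maximal clique by itself.
  in-clique : ∀ v → ∃ λ i → v ∈ C i
  in-clique v with Fₚ.any? (λ i → v Sₚ.∈? C i)
  ... | yes v∈ = v∈
  ... | no v∉ = map₂ (λ eq → subst (v ∈_) (≡-sym eq) (Sₚ.x∈⁅x⁆ v)) (complete ⁅ v ⁆ (isClique , isMaximal))
    where
    isClique : IsClique G ⁅ v ⁆
    isClique u w u∈ w∈ u≢w = contradiction (trans (Sₚ.x∈⁅y⁆⇒x≡y v u∈) (≡-sym (Sₚ.x∈⁅y⁆⇒x≡y v w∈))) u≢w
    isMaximal : ∀ w → w ∉ ⁅ v ⁆ → ∃ λ u → u ∈ ⁅ v ⁆ × u ≢ w × ¬ Adj G w u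
    isMaximal w w∉ = v , Sₚ.x∈⁅x⁆ v , (λ { refl → w∉ (Sₚ.x∈⁅x⁆ v) }) ,
      λ wv → let i , _ , v∈ = edge w v wv in v∉ (i , v∈)

  ∈? : ∀ v → Decidable (λ i → v ∈ C i)
  ∈? v i = v Sₚ.∈? C i

  indices : Fin (n G) → List (Fin (suc s))
  indices v = filter (∈? v) (allFin (suc s))

  ∈-indices : ∀ {v i} → v ∈ C i → i ∈ₗ indices v
  ∈-indices {v} {i} = Mₚ.∈-filter⁺ (∈? v) (Mₚ.∈-allFin i)

  leftmost : ∀ v → ∃ λ i → i ∈ₗ indices v × (∀ {j} → j ∈ₗ indices v → toℕ i ≤ toℕ j)
  leftmost v = least toℕ (∈-indices (proj₂ (in-clique v)))

  rightmost : ∀ v → ∃ λ i → i ∈ₗ indices v × (∀ {j} → j ∈ₗ indices v → s ∸ toℕ i ≤ s ∸ toℕ j)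
  rightmost v = least (λ i → s ∸ toℕ i) (∈-indices (proj₂ (in-clique v)))

  l r : Fin (n G) → Fin (suc s)
  l v = proj₁ (leftmost v)
  r v = proj₁ (rightmost v)

  l∈ : ∀ v → v ∈ C (l v)
  l∈ v = proj₂ (Mₚ.∈-filter⁻ (∈? v) {xs = allFin (suc s)} (proj₁ (proj₂ (leftmost v))))

  r∈ : ∀ v → v ∈ C (r v)
  r∈ v = proj₂ (Mₚ.∈-filter⁻ (∈? v) {xs = allFin (suc s)} (proj₁ (proj₂ (rightmost v))))

  l≤ : ∀ {v i} → v ∈ C i → toℕ (l v) ≤ toℕ i
  l≤ {v} v∈ = proj₂ (proj₂ (leftmost v)) (∈-indices v∈)

  ≤r : ∀ {v i} → v ∈ C i → toℕ i ≤ toℕ (r v)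
  ≤r {v} {i} v∈ = ℕₚ.∸-cancelʳ-≤ (Fₚ.toℕ≤pred[n] i) (proj₂ (proj₂ (rightmost v)) (∈-indices v∈))

  adj⇒≤ : ∀ {u v} → Adj G u v → toℕ (l u) ≤ toℕ (r v)
  adj⇒≤ {u} {v} uv with i , u∈ , v∈ ← edge u v uv = ≤-trans (l≤ u∈) (≤r v∈)

  -- The larger of the two left indices lies in both index ranges, so by convexity the clique there
  -- contains both vertices.
  ≤⇒adj : ∀ {u v} → u ≢ v → toℕ (l u) ≤ toℕ (r v) → toℕ (l v) ≤ toℕ (r u) → Adj G u v
  ≤⇒adj {u} {v} u≢v lu≤rv lv≤ru with ≤-total (toℕ (l u)) (toℕ (l v))
  ... | inj₁ lu≤lv = proj₁ (maximal (l v)) u v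
          (convex u (l u) (l v) (r u) lu≤lv lv≤ru (l∈ u) (r∈ u)) (l∈ v) u≢v
  ... | inj₂ lv≤lu = proj₁ (maximal (l u)) u v
          (l∈ u) (convex v (l v) (l u) (r v) lv≤lu lu≤rv (l∈ v) (r∈ v)) u≢v

  open Intervals G (toℕ ∘ l) (toℕ ∘ r) s (λ v → l≤ (r∈ v)) (λ v → Fₚ.toℕ≤pred[n] (r v)) adj⇒≤ ≤⇒adj public
    using (module Ends)

theorem2 : (G : Graph) → IsIntervalGraph G →
    (s : ℕ) (C : Fin (suc s) → Subset (n G)) → IsCliquePath G (suc s) C →
    (u₁ uₙ : Fin (n G)) → u₁ ≢ uₙ →
    u₁ ∈ C zero → (∀ j → j ≢ zero → u₁ ∉ C j) →
    uₙ ∈ C (fromℕ s) → (∀ j → j ≢ fromℕ s → uₙ ∉ C j) →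
    (p : ℕ) → 1 ≤ p →
    (SpanningStave G p u₁ uₙ ⇔ ScatLe G ((+ 2) - (+ p)))
theorem2 G _ s C cliquePath u₁ uₙ u₁≢uₙ _ u₁-only _ uₙ-only (suc p) _ =
  mk⇔ stave⇒scat (Sufficiency.scat⇒stave p)
  where
  open CliquePath G cliquePath
  r[u₁] : r u₁ ≡ zero
  r[u₁] = decidable-stable (r u₁ F.≟ zero) (λ r≢ → u₁-only (r u₁) r≢ (r∈ u₁))
  l[uₙ] : l uₙ ≡ fromℕ s
  l[uₙ] = decidable-stable (l uₙ F.≟ fromℕ s) (λ l≢ → uₙ-only (l uₙ) l≢ (l∈ uₙ))
  open Ends u₁ uₙ u₁≢uₙ (cong toℕ r[u₁]) (trans (cong toℕ l[uₙ]) (Fₚ.toℕ-fromℕ s))
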